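{- Let $1\le k<m$ be integers, let $N>(2^m)!$ be an integer, and let $f^*:2^{[m]}\to\mathbb{R}$ be the set function with $f^*(\emptyset)=0$ whose $W$-coefficients are $w(S)=N$ for all non-empty $S\subseteq[m]$ with $|S|\le k$ and $w(S)=-1$ for all $S\subseteq[m]$ with $|S|>k$. Let $\mathcal{J}\subseteq 2^{[m]}$ be any collection of sets with $|\mathcal{J}|<2^k$. Then there exists a coverage function $f:2^{[m]}\to\mathbb{R}_{\ge 0}$ with $f(T)=f^*(T)$ for all $T\in\mathcal{J}$.
   Context: $[m]=\{1,\dots,m\}$. A function $f:2^{[m]}\to\mathbb{R}_{\ge 0}$ is a coverage function if there exist a finite set $U$, weights $w_u\ge 0$ for $u\in U$, and sets $A_1,\dots,A_m\subseteq U$ such that $f(T)=\sum_{u\in\bigcup_{i\in T}A_i} w_u$ for all $T\subseteq[m]$. The $W$-coefficients of a set function $f$ with $f(\emptyset)=0$ are, for each non-empty $S\subseteq[m]$, $w(S)=\sum_{T:\,S\cup T=[m]}(-1)^{|S\cap T|+1}f(T)$; equivalently they are the unique reals with $f(T)=\sum_{S:\,S\cap T\ne\emptyset}w(S)$ for all $T\subseteq[m]$. In particular $f^*(T)=\sum_{S:\,S\cap T\ne\emptyset}w(S)$ with the $w(S)$ given in the claim. -}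

module Defs where

open import Data.Bool.Properties using () renaming (_≟_ to _≟ᵇ_)
open import Data.Fin using (Fin)
open import Data.Fin.Subset using (Subset; inside; outside; ⊤; _∪_; _∩_; ⋃; ∣_∣)
open import Data.Fin.Subset.Properties using (_∈?_)
open import Data.Integer using (ℤ; +_)
open import Data.List using (List; []; _∷_; _++_; map; filter; foldr; allFin; length)
open import Data.Nat using (ℕ; zero; suc; _≥_; _⊔_)
open import Data.Nat.Properties using (m⊔n≤o⇒m≤o; m⊔n≤o⇒n≤o)
open import Data.Product using (∃; ∃-syntax; _,_)
open import Data.Rational as ℚ using (ℚ; 0ℚ; ½)
import Data.Rational.Properties as ℚ
open import Data.Vec using ([]; _∷_)
open import Data.Vec.Properties using (≡-dec)
open import Relation.Binary.PropositionalEquality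
  using (_≡_; sym; trans; cong; subst; module ≡-Reasoning)
open import Relation.Unary using (Pred; Decidable)

------------------------------------------------------------------------
-- Real numbers: Cauchy sequences of rationals with modulus, considered up
-- to the setoid equality _≈_.

IsCauchy : (ℕ → ℚ) → Set
IsCauchy x = ∀ ε → 0ℚ ℚ.< ε →
  ∃[ n₀ ] (∀ i j → i ≥ n₀ → j ≥ n₀ → ℚ.∣ x i ℚ.- x j ∣ ℚ.< ε)

record ℝ : Set where
  constructor mkℝ
  field
    seq    : ℕ → ℚ
    cauchy : IsCauchy seq

open ℝ public

infix 4 _≈_ _≤ᴿ_

_≈_ : ℝ → ℝ → Set
x ≈ y = ∀ ε → 0ℚ ℚ.< ε →
  ∃[ n₀ ] (∀ i → i ≥ n₀ → ℚ.∣ seq x i ℚ.- seq y i ∣ ℚ.< ε)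

_≤ᴿ_ : ℝ → ℝ → Set
x ≤ᴿ y = ∀ ε → 0ℚ ℚ.< ε →
  ∃[ n₀ ] (∀ i → i ≥ n₀ → seq x i ℚ.< seq y i ℚ.+ ε)

fromℚ : ℚ → ℝ
fromℚ q = mkℝ (λ _ → q) λ ε 0<ε →
  0 , λ _ _ _ _ → subst (ℚ._< ε) (sym (cong ℚ.∣_∣ (ℚ.+-inverseʳ q))) 0<ε

fromℤ : ℤ → ℝ
fromℤ z = fromℚ (z ℚ./ 1)

0ᴿ : ℝ
0ᴿ = fromℚ 0ℚ

private
  half-pos : ∀ {ε} → 0ℚ ℚ.< ε → 0ℚ ℚ.< ½ ℚ.* ε
  half-pos {ε} 0<ε = subst (ℚ._< ½ ℚ.* ε) (ℚ.*-zeroʳ ½) (ℚ.*-monoʳ-<-pos ½ 0<ε)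

  half+half : ∀ ε → ½ ℚ.* ε ℚ.+ ½ ℚ.* ε ≡ ε
  half+half ε = trans (sym (ℚ.*-distribʳ-+ ε ½ ½)) (ℚ.*-identityˡ ε)

  +-interchange : ∀ a b c d →
    (a ℚ.+ b) ℚ.+ (c ℚ.+ d) ≡ (a ℚ.+ c) ℚ.+ (b ℚ.+ d)
  +-interchange a b c d = begin
    (a ℚ.+ b) ℚ.+ (c ℚ.+ d)   ≡⟨ ℚ.+-assoc a b (c ℚ.+ d) ⟩
    a ℚ.+ (b ℚ.+ (c ℚ.+ d))   ≡⟨ cong (a ℚ.+_) (sym (ℚ.+-assoc b c d)) ⟩
    a ℚ.+ ((b ℚ.+ c) ℚ.+ d)   ≡⟨ cong (λ t → a ℚ.+ (t ℚ.+ d)) (ℚ.+-comm b c) ⟩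
    a ℚ.+ ((c ℚ.+ b) ℚ.+ d)   ≡⟨ cong (a ℚ.+_) (ℚ.+-assoc c b d) ⟩
    a ℚ.+ (c ℚ.+ (b ℚ.+ d))   ≡⟨ sym (ℚ.+-assoc a c (b ℚ.+ d)) ⟩
    (a ℚ.+ c) ℚ.+ (b ℚ.+ d)   ∎
    where open ≡-Reasoning

  sub-+ : ∀ a b c d →
    (a ℚ.+ b) ℚ.- (c ℚ.+ d) ≡ (a ℚ.- c) ℚ.+ (b ℚ.- d)
  sub-+ a b c d = trans (cong ((a ℚ.+ b) ℚ.+_) (ℚ.neg-distrib-+ c d))
                        (+-interchange a b (ℚ.- c) (ℚ.- d))

infixl 6 _+ᴿ_
infix  8 -ᴿ_

_+ᴿ_ : ℝ → ℝ → ℝ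
x +ᴿ y = mkℝ (λ i → seq x i ℚ.+ seq y i) λ ε 0<ε →
  let (n₁ , p₁) = cauchy x (½ ℚ.* ε) (half-pos 0<ε)
      (n₂ , p₂) = cauchy y (½ ℚ.* ε) (half-pos 0<ε)
  in n₁ ⊔ n₂ , λ i j i≥ j≥ →
     subst (λ t → ℚ.∣ t ∣ ℚ.< ε) (sym (sub-+ (seq x i) (seq y i) (seq x j) (seq y j)))
       (ℚ.≤-<-trans
         (ℚ.∣p+q∣≤∣p∣+∣q∣ (seq x i ℚ.- seq x j) (seq y i ℚ.- seq y j))
         (subst (ℚ.∣ seq x i ℚ.- seq x j ∣ ℚ.+ ℚ.∣ seq y i ℚ.- seq y j ∣ ℚ.<_)
           (half+half ε)
           (ℚ.+-mono-<
             (p₁ i j (m⊔n≤o⇒m≤o n₁ n₂ i≥) (m⊔n≤o⇒m≤o n₁ n₂ j≥))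
             (p₂ i j (m⊔n≤o⇒n≤o n₁ n₂ i≥) (m⊔n≤o⇒n≤o n₁ n₂ j≥)))))

-ᴿ_ : ℝ → ℝ
-ᴿ x = mkℝ (λ i → ℚ.- seq x i) λ ε 0<ε →
  let (n₀ , p) = cauchy x ε 0<ε
  in n₀ , λ i j i≥ j≥ →
     subst (ℚ._< ε)
       (trans (sym (ℚ.∣-p∣≡∣p∣ (seq x i ℚ.- seq x j)))
              (cong ℚ.∣_∣ (ℚ.neg-distrib-+ (seq x i) (ℚ.- seq x j))))
       (p i j i≥ j≥)

record ℝ≥0 : Set where
  constructor mkℝ≥0
  field
    real   : ℝ
    nonneg : 0ᴿ ≤ᴿ real

open ℝ≥0 public

-- (-1)ⁿ x
sign : ℕ → ℝ → ℝ
sign zero    x = x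
sign (suc n) x = -ᴿ sign n x

∑ : ∀ {a} {A : Set a} → List A → (A → ℝ) → ℝ
∑ xs f = foldr (λ x s → f x +ᴿ s) 0ᴿ xs

------------------------------------------------------------------------
-- Set functions on 2^[m], with [m] rendered as Fin m

-- Every subset of [m] occurs exactly once.
allSubsets : ∀ m → List (Subset m)
allSubsets zero    = [] ∷ []
allSubsets (suc m) = map (outside ∷_) (allSubsets m) ++ map (inside ∷_) (allSubsets m)

-- Cardinality of a (decidable) collection of subsets of [m]
card : ∀ {m ℓ} {𝒥 : Pred (Subset m) ℓ} → Decidable 𝒥 → ℕ
card {m} 𝒥? = length (filter 𝒥? (allSubsets m))

elements : ∀ {n} → Subset n → List (Fin n)
elements {n} S = filter (_∈? S) (allFin n)

-- The finite ground set U is taken to be Fin n.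
IsCoverage : ∀ {m} → (Subset m → ℝ≥0) → Set
IsCoverage {m} f =
  ∃[ n ] ∃ λ (w : Fin n → ℝ≥0) → ∃ λ (A : Fin m → Subset n) →
    ∀ T → real (f T) ≈ ∑ (elements (⋃ (map A (elements T)))) (λ u → real (w u))

-- ∑ over all T with S ∪ T = [m] of (-1)^(|S ∩ T| + 1) f(T); this is used only
-- for non-empty S and for f with f(∅) = 0.
wCoeff : ∀ {m} → (Subset m → ℝ) → Subset m → ℝ
wCoeff {m} f S =
  ∑ (filter (λ T → ≡-dec _≟ᵇ_ (S ∪ T) ⊤) (allSubsets m))
    (λ T → sign (suc ∣ S ∩ T ∣) (f T))

{-# OPTIONS --safe #-}
module Submission where

-- Write y_i(T) = [i ∉ T], so that the monomial y^R is the indicator of R ∩ T = ∅ and f*(T) is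
-- determined, through Möbius inversion, by the sums of w(R) y^R(T).  Let L = 𝒥 ∪ {∅}, a family of at
-- most 2^k sets.  If |S| > k, some pattern A ⊆ S is not the trace on S of any T ∈ L, so that
-- ∏_{i ∈ S∖A} y_i ∏_{i ∈ A} (y_i - 1) vanishes on L.  It is y^S plus an integer combination of the y^R
-- with R ⊊ S whose coefficients lie in {-1, 0, 1}.  Adding b(S) times this relation for every S with
-- |S| > k leaves f* unchanged on L, and the new weights are nonnegative if b(S) exceeds the sum of
-- b(S') over all S' ⊋ S and the sum of b over all large sets is at most N.  The choice
-- b(S) = (2^(m - |S|))! achieves both.

open import Defs
open import Algebra.Bundles using (AbelianGroup; CommutativeMonoid)
import Algebra.Properties.AbelianGroup as AbelianGroupProperties
import Algebra.Properties.CommutativeSemigroup as CommutativeSemigroupProperties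
open import Data.Bool using (Bool; true; false; if_then_else_; not; _∧_; _∨_)
open import Data.Bool.Properties using () renaming (_≟_ to _≟ᵇ_)
open import Data.Fin using (Fin; zero; suc)
open import Data.Fin.Subset as Subset using (Subset; Nonempty; ⊥; ∣_∣; inside; outside; ⊤; ∁; _∪_; _∩_; ⋃)
open import Data.Fin.Subset.Properties using (_∈?_; ∉⊥; ∣p∣≤n; x∈p∪q⁺; x∈p∪q⁻)
open import Data.Integer as ℤ using (ℤ; +_; -1ℤ; 0ℤ)
import Data.Integer.Properties as ℤ
open import Data.List as List using (List; []; _∷_; _++_; map; filter; length; allFin)
open import Data.List.Membership.Propositional using (_∈_)
open import Data.List.Membership.Propositional.Properties
  using (∈-map⁺; ∈-++⁺ˡ; ∈-++⁺ʳ; ∈-filter⁺; ∈-filter⁻; ∈-allFin)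
open import Data.List.Properties using (length-map; map-tabulate; tabulate-lookup)
open import Data.List.Relation.Unary.Any using (here; there)
open import Data.Nat as ℕ using (ℕ; zero; suc; pred; _+_; _*_; _^_; _!; _≤_; _<_; _⊔_; z≤n; s≤s)
import Data.Nat.Properties as ℕ
open import Data.Product using (∃; _×_; _,_; proj₂; map₂)
open import Data.Rational as ℚ using (ℚ; 0ℚ; ½)
import Data.Rational.Properties as ℚ
open import Data.Rational.Solver using (module +-*-Solver)
open import Data.Rational.Unnormalised as ℚᵘ using (mkℚᵘ)
import Data.Rational.Unnormalised.Properties as ℚᵘ
open import Data.Sum using (inj₁; inj₂)
open import Data.Vec as Vec using ([]; _∷_; tail; here; there)
open import Data.Vec.Properties using (≡-dec; lookup⇒[]=; []=⇒lookup; lookup∘tabulate)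
open import Function using (id)
open import Relation.Binary.PropositionalEquality as ≡ using (_≡_)
import Relation.Binary.Reasoning.Setoid as SetoidReasoning
open import Relation.Nullary using (does; yes; no; contradiction)
open import Relation.Nullary.Reflects using (Reflects; ofʸ; ofⁿ; det)
open import Relation.Unary using (Pred; Decidable)

-- Finite sums with Boolean indicators

meets : ∀ {m} → Subset m → Subset m → Bool
meets []      []      = false
meets (s ∷ S) (t ∷ T) = (s ∧ t) ∨ meets S T

covers : ∀ {m} → Subset m → Subset m → Bool
covers S T = does (≡-dec _≟ᵇ_ (S ∪ T) ⊤)

module Sum {c ℓ} (M : CommutativeMonoid c ℓ) where
  open CommutativeMonoid M renaming (_≈_ to _∼_)
  open CommutativeSemigroupProperties commutativeSemigroup using (interchange)

  sum : ∀ {a} {A : Set a} → List A → (A → Carrier) → Carrier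
  sum []       f = ε
  sum (x ∷ xs) f = f x ∙ sum xs f

  -- Multiplication by a 0/1 indicator without a ring structure; it turns a sum over a filtered list
  -- into a sum over the whole list.
  infix 8 [_]·_
  [_]·_ : Bool → Carrier → Carrier
  [ b ]· x = if b then x else ε

  module _ {a} {A : Set a} where

    sum-cong : ∀ (xs : List A) {f g} → (∀ x → f x ∼ g x) → sum xs f ∼ sum xs g
    sum-cong []       f∼g = refl
    sum-cong (x ∷ xs) f∼g = ∙-cong (f∼g x) (sum-cong xs f∼g)

    sum-ε : ∀ (xs : List A) {f} → (∀ x → f x ∼ ε) → sum xs f ∼ ε
    sum-ε []       f∼ε = refl
    sum-ε (x ∷ xs) f∼ε = trans (∙-cong (f∼ε x) (sum-ε xs f∼ε)) (identityˡ ε)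

    sum-∙ : ∀ (xs : List A) f g → sum xs (λ x → f x ∙ g x) ∼ sum xs f ∙ sum xs g
    sum-∙ []       f g = sym (identityˡ ε)
    sum-∙ (x ∷ xs) f g = trans (∙-congˡ (sum-∙ xs f g)) (interchange _ _ _ _)

    sum-++ : ∀ (xs ys : List A) f → sum (xs ++ ys) f ∼ sum xs f ∙ sum ys f
    sum-++ []       ys f = sym (identityˡ _)
    sum-++ (x ∷ xs) ys f = trans (∙-congˡ (sum-++ xs ys f)) (sym (assoc _ _ _))

    sum-filter : ∀ {p} {P : Pred A p} (P? : Decidable P) xs f →
      sum (filter P? xs) f ∼ sum xs (λ x → [ does (P? x) ]· f x)
    sum-filter P? []       f = refl
    sum-filter P? (x ∷ xs) f with does (P? x)
    ... | true  = ∙-congˡ (sum-filter P? xs f)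
    ... | false = trans (sum-filter P? xs f) (sym (identityˡ _))

    sum-map : ∀ {b} {B : Set b} (h : A → B) xs f → sum (map h xs) f ≡ sum xs (λ x → f (h x))
    sum-map h []       f = ≡.refl
    sum-map h (x ∷ xs) f = ≡.cong (f (h x) ∙_) (sum-map h xs f)

  sum-swap : ∀ {a b} {A : Set a} {B : Set b} (xs : List A) (ys : List B) (f : A → B → Carrier) →
    sum xs (λ x → sum ys (f x)) ∼ sum ys (λ y → sum xs (λ x → f x y))
  sum-swap []       ys f = sym (sum-ε ys (λ _ → refl))
  sum-swap (x ∷ xs) ys f =
    trans (∙-congˡ (sum-swap xs ys f)) (sym (sum-∙ ys (f x) _))

  []·-cong : ∀ b {x y} → x ∼ y → [ b ]· x ∼ [ b ]· y
  []·-cong true  x∼y = x∼y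
  []·-cong false x∼y = refl

  []·-∙ : ∀ b x y → [ b ]· (x ∙ y) ∼ [ b ]· x ∙ [ b ]· y
  []·-∙ true  x y = refl
  []·-∙ false x y = sym (identityˡ ε)

  []·-ε : ∀ b → [ b ]· ε ∼ ε
  []·-ε true  = refl
  []·-ε false = refl

  []·-not : ∀ b x → [ b ]· x ∙ [ not b ]· x ∼ x
  []·-not true  x = identityʳ x
  []·-not false x = identityˡ x

  []·-sum : ∀ {a} {A : Set a} b (xs : List A) f → [ b ]· sum xs f ∼ sum xs (λ x → [ b ]· f x)
  []·-sum true  xs f = refl
  []·-sum false xs f = sym (sum-ε xs (λ _ → refl))

  sum-allSubsets-suc : ∀ m f →
    sum (allSubsets (suc m)) f ∼
    sum (allSubsets m) (λ S → f (outside ∷ S)) ∙ sum (allSubsets m) (λ S → f (inside ∷ S))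
  sum-allSubsets-suc m f = trans (sum-++ (map (outside ∷_) (allSubsets m)) _ f)
    (reflexive (≡.cong₂ _∙_ (sum-map (outside ∷_) (allSubsets m) f)
                            (sum-map (inside ∷_) (allSubsets m) f)))

-- Inversion of the W-coefficients in an abelian group

module Inversion {c ℓ} (G : AbelianGroup c ℓ) where
  open AbelianGroup G renaming (_≈_ to _∼_)
  open AbelianGroupProperties G using (ε⁻¹≈ε; ⁻¹-∙-comm; ⁻¹-involutive)
  open Sum commutativeMonoid
  open SetoidReasoning setoid

  []·-⁻¹ : ∀ b x → [ b ]· (x ⁻¹) ∼ ([ b ]· x) ⁻¹
  []·-⁻¹ true  x = refl
  []·-⁻¹ false x = sym ε⁻¹≈ε

  sum-⁻¹ : ∀ {a} {A : Set a} (xs : List A) f → sum xs (λ x → f x ⁻¹) ∼ (sum xs f) ⁻¹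
  sum-⁻¹ []       f = sym ε⁻¹≈ε
  sum-⁻¹ (x ∷ xs) f = trans (∙-congˡ (sum-⁻¹ xs f)) (⁻¹-∙-comm _ _)

  alternate : ℕ → Carrier → Carrier
  alternate zero    x = x
  alternate (suc n) x = alternate n x ⁻¹

  W-term : ∀ {m} → (Subset m → Carrier) → Subset m → Subset m → Carrier
  W-term f S T = alternate (suc ∣ S ∩ T ∣) (f T)

  -- The empty set is included as an index, with value the inverse of `f ⊤`; this makes the
  -- recursion on `m` and the total `sum-W` uniform.
  W : ∀ {m} → (Subset m → Carrier) → Subset m → Carrier
  W {m} f S = sum (allSubsets m) (λ T → [ covers S T ]· W-term f S T)

  -- If `S` omits the first element, a covering partner `T` must contain it, and `S ∩ T` does not
  -- grow, so the signs stay the same.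
  W-outside : ∀ {m} (f : Subset (suc m) → Carrier) S →
    W f (outside ∷ S) ∼ W (λ T → f (inside ∷ T)) S
  W-outside {m} f S = begin
    W f (outside ∷ S)                              ≈⟨ sum-allSubsets-suc m _ ⟩
    sum (allSubsets m) _ ∙ W (λ T → f (inside ∷ T)) S  ≈⟨ ∙-congʳ (sum-ε (allSubsets m) (λ _ → refl)) ⟩
    ε ∙ W (λ T → f (inside ∷ T)) S                 ≈⟨ identityˡ _ ⟩
    W (λ T → f (inside ∷ T)) S                     ∎

  -- If `S` contains the first element, `T` may or may not contain it; when it does, `S ∩ T` gains
  -- an element and the sign flips.
  W-inside : ∀ {m} (f : Subset (suc m) → Carrier) S →
    W f (inside ∷ S) ∼ W (λ T → f (outside ∷ T)) S ∙ W (λ T → f (inside ∷ T)) S ⁻¹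
  W-inside {m} f S = begin
    W f (inside ∷ S)                                ≈⟨ sum-allSubsets-suc m _ ⟩
    W f₀ S ∙ sum (allSubsets m) (λ T → [ covers S T ]· (W-term f₁ S T ⁻¹))
      ≈⟨ ∙-congˡ (sum-cong (allSubsets m) (λ T → []·-⁻¹ (covers S T) _)) ⟩
    W f₀ S ∙ sum (allSubsets m) (λ T → ([ covers S T ]· W-term f₁ S T) ⁻¹)
      ≈⟨ ∙-congˡ (sum-⁻¹ (allSubsets m) _) ⟩
    W f₀ S ∙ W f₁ S ⁻¹ ∎
    where
    f₀ f₁ : Subset m → Carrier
    f₀ T = f (outside ∷ T)
    f₁ T = f (inside ∷ T)

  cancel-mid : ∀ x y → x ∙ (y ∙ x ⁻¹) ∼ y
  cancel-mid x y = begin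
    x ∙ (y ∙ x ⁻¹)   ≈⟨ ∙-congˡ (comm y (x ⁻¹)) ⟩
    x ∙ (x ⁻¹ ∙ y)   ≈⟨ assoc x (x ⁻¹) y ⟨
    x ∙ x ⁻¹ ∙ y     ≈⟨ ∙-congʳ (inverseʳ x) ⟩
    ε ∙ y            ≈⟨ identityˡ y ⟩
    y                ∎

  -- The coefficients at `outside ∷ S` and `inside ∷ S` add up to one coefficient of the restriction
  -- to sets without the first element. Repeating this leaves only the value at `⊥`.
  sum-W : ∀ {m} (f : Subset m → Carrier) → sum (allSubsets m) (W f) ∼ f ⊥ ⁻¹
  sum-W {zero}  f = trans (identityʳ _) (identityʳ _)
  sum-W {suc m} f = begin
    sum (allSubsets (suc m)) (W f)                  ≈⟨ sum-allSubsets-suc m (W f) ⟩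
    sum (allSubsets m) (λ S → W f (outside ∷ S)) ∙ sum (allSubsets m) (λ S → W f (inside ∷ S))
      ≈⟨ sum-∙ (allSubsets m) _ _ ⟨
    sum (allSubsets m) (λ S → W f (outside ∷ S) ∙ W f (inside ∷ S))
      ≈⟨ sum-cong (allSubsets m) (λ S → trans (∙-cong (W-outside f S) (W-inside f S)) (cancel-mid _ _)) ⟩
    sum (allSubsets m) (W (λ T → f (outside ∷ T)))  ≈⟨ sum-W (λ T → f (outside ∷ T)) ⟩
    f ⊥ ⁻¹                                          ∎

  -- Induction on `m`. If `T` omits the first element, both extensions of `S` meet `T` under the
  -- same condition and merge as in `sum-W`. If `T` contains it, every `inside ∷ S` meets `T`; by
  -- `sum-W` these contribute `f₁ ⊥` minus `f ⊥`, which replaces the constant `f ⊥` by `f₁ ⊥`.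
  W-inversion : ∀ {m} (f : Subset m → Carrier) T →
    f T ∼ f ⊥ ∙ sum (allSubsets m) (λ S → [ meets S T ]· W f S)
  W-inversion {zero}  f []            = sym (trans (∙-congˡ (identityʳ ε)) (identityʳ _))
  W-inversion {suc m} f (outside ∷ T) = sym (begin
    f ⊥ ∙ sum (allSubsets (suc m)) (λ S → [ meets S (outside ∷ T) ]· W f S)
      ≈⟨ ∙-congˡ (sum-allSubsets-suc m _) ⟩
    f ⊥ ∙ (sum (allSubsets m) (λ S → [ meets S T ]· W f (outside ∷ S))
         ∙ sum (allSubsets m) (λ S → [ meets S T ]· W f (inside ∷ S)))
      ≈⟨ ∙-congˡ (sum-∙ (allSubsets m) _ _) ⟨
    f ⊥ ∙ sum (allSubsets m) (λ S → [ meets S T ]· W f (outside ∷ S) ∙ [ meets S T ]· W f (inside ∷ S))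
      ≈⟨ ∙-congˡ (sum-cong (allSubsets m) (λ S → trans (sym ([]·-∙ (meets S T) _ _))
           ([]·-cong (meets S T) (trans (∙-cong (W-outside f S) (W-inside f S)) (cancel-mid _ _))))) ⟩
    f ⊥ ∙ sum (allSubsets m) (λ S → [ meets S T ]· W (λ T → f (outside ∷ T)) S)
      ≈⟨ W-inversion (λ T → f (outside ∷ T)) T ⟨
    f (outside ∷ T) ∎)
  W-inversion {suc m} f (inside ∷ T) = sym (begin
    f ⊥ ∙ sum (allSubsets (suc m)) (λ S → [ meets S (inside ∷ T) ]· W f S)
      ≈⟨ ∙-congˡ (sum-allSubsets-suc m _) ⟩
    f ⊥ ∙ (sum (allSubsets m) (λ S → [ meets S T ]· W f (outside ∷ S))
         ∙ sum (allSubsets m) (λ S → W f (inside ∷ S)))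
      ≈⟨ ∙-congˡ (∙-cong
           (sum-cong (allSubsets m) (λ S → []·-cong (meets S T) (W-outside f S)))
           (trans (sum-cong (allSubsets m) (W-inside f))
             (trans (sum-∙ (allSubsets m) _ _)
               (∙-cong (sum-W f₀) (trans (sum-⁻¹ (allSubsets m) _) (⁻¹-cong (sum-W f₁))))))) ⟩
    f ⊥ ∙ (V ∙ (f ⊥ ⁻¹ ∙ (f₁ ⊥ ⁻¹) ⁻¹))
      ≈⟨ ∙-congˡ (comm _ _) ⟩
    f ⊥ ∙ (f ⊥ ⁻¹ ∙ (f₁ ⊥ ⁻¹) ⁻¹ ∙ V)
      ≈⟨ ∙-congˡ (trans (∙-congʳ (comm _ _)) (trans (assoc _ _ _) (trans (∙-congˡ (comm _ _)) (sym (assoc _ _ _))))) ⟩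
    f ⊥ ∙ ((f₁ ⊥ ⁻¹) ⁻¹ ∙ V ∙ f ⊥ ⁻¹)
      ≈⟨ cancel-mid _ _ ⟩
    (f₁ ⊥ ⁻¹) ⁻¹ ∙ V
      ≈⟨ ∙-congʳ (⁻¹-involutive (f₁ ⊥)) ⟩
    f₁ ⊥ ∙ V
      ≈⟨ W-inversion f₁ T ⟨
    f (inside ∷ T) ∎)
    where
    f₀ f₁ : Subset m → Carrier
    f₀ T = f (outside ∷ T)
    f₁ T = f (inside ∷ T)
    V : Carrier
    V = sum (allSubsets m) (λ S → [ meets S T ]· W f₁ S)

module ℕΣ = Sum ℕ.+-0-commutativeMonoid
module ℤΣ = Sum (AbelianGroup.commutativeMonoid ℤ.+-0-abelianGroup)
module ℤInversion = Inversion ℤ.+-0-abelianGroup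

-- Superset sums and the factorial costs

infix 4 _⊆ᵇ_
_⊆ᵇ_ : ∀ {m} → Subset m → Subset m → Bool
[]            ⊆ᵇ []      = true
(outside ∷ R) ⊆ᵇ (s ∷ S) = R ⊆ᵇ S
(inside ∷ R)  ⊆ᵇ (s ∷ S) = s ∧ (R ⊆ᵇ S)

⊆ᵇ-refl : ∀ {m} (S : Subset m) → (S ⊆ᵇ S) ≡ true
⊆ᵇ-refl []            = ≡.refl
⊆ᵇ-refl (outside ∷ S) = ⊆ᵇ-refl S
⊆ᵇ-refl (inside ∷ S)  = ⊆ᵇ-refl S

meets-⊥ : ∀ {m} (S : Subset m) → meets S ⊥ ≡ false
meets-⊥ []            = ≡.refl
meets-⊥ (outside ∷ S) = meets-⊥ S
meets-⊥ (inside ∷ S)  = meets-⊥ S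

∈-allSubsets : ∀ {m} (S : Subset m) → S ∈ allSubsets m
∈-allSubsets []            = here ≡.refl
∈-allSubsets (outside ∷ S) = ∈-++⁺ˡ (∈-map⁺ _ (∈-allSubsets S))
∈-allSubsets (inside ∷ S)  = ∈-++⁺ʳ (map (outside ∷_) (allSubsets _)) (∈-map⁺ _ (∈-allSubsets S))

-- The summand depends on `R` only through the size of its complement, so removing a coordinate at
-- most shifts `β`.
supersetSum : ∀ {m} → (ℕ → ℕ) → Subset m → ℕ
supersetSum {m} β S = ℕΣ.sum (allSubsets m) (λ R → ℕΣ.[ S ⊆ᵇ R ]· β ∣ ∁ R ∣)

supersetSum-outside : ∀ {m} β (S : Subset m) →
  supersetSum β (outside ∷ S) ≡ supersetSum (λ d → β (suc d)) S + supersetSum β S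
supersetSum-outside {m} β S = ℕΣ.sum-allSubsets-suc m _

supersetSum-inside : ∀ {m} β (S : Subset m) → supersetSum β (inside ∷ S) ≡ supersetSum β S
supersetSum-inside {m} β S = ≡.trans (ℕΣ.sum-allSubsets-suc m _)
  (≡.cong (_+ supersetSum β S) (ℕΣ.sum-ε (allSubsets m) (λ _ → ≡.refl)))

-- There are `2 ^ ∣ ∁ S ∣` supersets of `S`, and each contributes at most `M`.
supersetSum-≤ : ∀ {m} β (S : Subset m) {M} → (∀ {j} → j ≤ ∣ ∁ S ∣ → β j ≤ M) →
  supersetSum β S ≤ 2 ^ ∣ ∁ S ∣ * M
supersetSum-≤ β []            β≤M = ℕ.+-monoˡ-≤ 0 (β≤M z≤n)
supersetSum-≤ β (inside ∷ S)  β≤M rewrite supersetSum-inside β S = supersetSum-≤ β S β≤M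
supersetSum-≤ β (outside ∷ S) {M} β≤M = begin
  supersetSum β (outside ∷ S)
    ≡⟨ supersetSum-outside β S ⟩
  supersetSum (λ d → β (suc d)) S + supersetSum β S
    ≤⟨ ℕ.+-mono-≤ (supersetSum-≤ _ S (λ j≤ → β≤M (s≤s j≤)))
                  (supersetSum-≤ β S (λ j≤ → β≤M (ℕ.m≤n⇒m≤1+n j≤))) ⟩
  P * M + P * M  ≡⟨ ℕ.*-distribʳ-+ M P P ⟨
  (P + P) * M    ≡⟨ ≡.cong (λ x → (P + x) * M) (ℕ.+-identityʳ P) ⟨
  (2 * P) * M    ∎
  where
  open ℕ.≤-Reasoning
  P = 2 ^ ∣ ∁ S ∣

-- `S` itself contributes `β ∣ ∁ S ∣`, and each of the `2 ^ ∣ ∁ S ∣ - 1` proper supersets at most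
-- `M`. The extra `M` on the left avoids subtraction.
properSupersetSum-≤ : ∀ {m} β (S : Subset m) {M} → (∀ {j} → j < ∣ ∁ S ∣ → β j ≤ M) →
  supersetSum β S + M ≤ β ∣ ∁ S ∣ + 2 ^ ∣ ∁ S ∣ * M
properSupersetSum-≤ β []            {M} β≤M = ℕ.≤-reflexive
  (≡.cong₂ _+_ (ℕ.+-identityʳ (β 0)) (≡.sym (ℕ.+-identityʳ M)))
properSupersetSum-≤ β (inside ∷ S)  β≤M rewrite supersetSum-inside β S = properSupersetSum-≤ β S β≤M
properSupersetSum-≤ β (outside ∷ S) {M} β≤M = begin
  supersetSum β (outside ∷ S) + M
    ≡⟨ ≡.cong (_+ M) (≡.trans (supersetSum-outside β S)
         (ℕ.+-comm (supersetSum (λ d → β (suc d)) S) (supersetSum β S))) ⟩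
  supersetSum β S + supersetSum (λ d → β (suc d)) S + M
    ≡⟨ ℕ.+-assoc (supersetSum β S) _ M ⟩
  supersetSum β S + (supersetSum (λ d → β (suc d)) S + M)
    -- Supersets containing the first element are all proper; `S` itself is counted among those
    -- omitting it.
    ≤⟨ ℕ.+-mono-≤ (supersetSum-≤ β S (λ j≤ → β≤M (s≤s j≤)))
                  (properSupersetSum-≤ _ S (λ j< → β≤M (s≤s j<))) ⟩
  P * M + (b + P * M)    ≡⟨ ℕ.+-comm (P * M) (b + P * M) ⟩
  b + P * M + P * M      ≡⟨ ℕ.+-assoc b (P * M) (P * M) ⟩
  b + (P * M + P * M)    ≡⟨ ≡.cong (λ x → b + x) (ℕ.*-distribʳ-+ M P P) ⟨
  b + (P + P) * M        ≡⟨ ≡.cong (λ x → b + (P + x) * M) (ℕ.+-identityʳ P) ⟨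
  b + (2 * P) * M        ∎
  where
  open ℕ.≤-Reasoning
  P = 2 ^ ∣ ∁ S ∣
  b = β (suc ∣ ∁ S ∣)

!-mono-≤ : ∀ {a b} → a ≤ b → a ! ≤ b !
!-mono-≤ {b = b} z≤n       = ℕ.1≤n! b
!-mono-≤         (s≤s a≤b) = ℕ.*-mono-≤ (s≤s a≤b) (!-mono-≤ a≤b)

n*pred!≡n! : ∀ n .{{_ : ℕ.NonZero n}} → n * (pred n) ! ≡ n !
n*pred!≡n! (suc n) = ≡.refl

-- The multiplier b(S) of the relation attached to `S`.
cost : ∀ {m} → Subset m → ℕ
cost S = (2 ^ ∣ ∁ S ∣) !

cost-≤ : ∀ {m} (S : Subset m) → cost S ≤ (2 ^ m) !
cost-≤ S = !-mono-≤ (ℕ.^-monoʳ-≤ 2 (∣p∣≤n (∁ S)))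

supersetCost : ∀ {m} → Subset m → ℕ
supersetCost {m} S = ℕΣ.sum (allSubsets m) (λ R → ℕΣ.[ S ⊆ᵇ R ]· cost R)

-- With `P = 2 ^ ∣ ∁ S ∣`, each of the `P - 1` proper supersets costs at most `(P - 1)!`, so
-- together they stay strictly below `P * (P - 1)! = cost S`. Strictness later pays for the weight
-- -1.
supersetCost-< : ∀ {m} (S : Subset m) → supersetCost S < cost S + cost S
supersetCost-< S = begin-strict
  supersetCost S        <⟨ ℕ.m<m+n (supersetCost S) (ℕ.1≤n! (pred P)) ⟩
  supersetCost S + (pred P) !
    ≤⟨ properSupersetSum-≤ (λ d → (2 ^ d) !) S
         (λ j<d → !-mono-≤ (ℕ.<⇒≤pred (ℕ.^-monoʳ-< 2 (s≤s (s≤s z≤n)) j<d))) ⟩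
  cost S + P * (pred P) !  ≡⟨ ≡.cong (λ x → cost S + x) (n*pred!≡n! P {{ℕ.m^n≢0 2 ∣ ∁ S ∣}}) ⟩
  cost S + cost S       ∎
  where
  open ℕ.≤-Reasoning
  P = 2 ^ ∣ ∁ S ∣

-- The coefficients, in the monomials y^R, of β ∏_{i ∈ S∖A} y_i ∏_{i ∈ A} (y_i - 1) for a suitable A.
record Annihilator {m} (L : List (Subset m)) (S : Subset m) (β : ℕ) : Set where
  field
    coeff       : Subset m → ℤ
    leading     : coeff S ≡ + β
    bounded     : ∀ R → ℤ.∣ coeff R ∣ ≤ ℕΣ.[ R ⊆ᵇ S ]· β
    annihilates : ∀ {T} → T ∈ L →
      ℤΣ.sum (allSubsets m) (λ R → ℤΣ.[ not (meets R T) ]· coeff R) ≡ 0ℤ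

-- Construction of annihilators, one coordinate at a time

tailsWith : ∀ {m} → Bool → List (Subset (suc m)) → List (Subset m)
tailsWith b       []                  = []
tailsWith inside  ((inside ∷ T) ∷ L)  = T ∷ tailsWith inside L
tailsWith inside  ((outside ∷ T) ∷ L) = tailsWith inside L
tailsWith outside ((inside ∷ T) ∷ L)  = tailsWith outside L
tailsWith outside ((outside ∷ T) ∷ L) = T ∷ tailsWith outside L

length-tailsWith : ∀ {m} (L : List (Subset (suc m))) →
  length (tailsWith outside L) + length (tailsWith inside L) ≡ length L
length-tailsWith []                  = ≡.refl
length-tailsWith ((outside ∷ T) ∷ L) = ≡.cong suc (length-tailsWith L)
length-tailsWith ((inside ∷ T) ∷ L)  =
  ≡.trans (ℕ.+-suc (length (tailsWith outside L)) _) (≡.cong suc (length-tailsWith L))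

∈-tailsWith-outside : ∀ {m} {T : Subset m} {L} → (outside ∷ T) ∈ L → T ∈ tailsWith outside L
∈-tailsWith-outside                          (here ≡.refl) = here ≡.refl
∈-tailsWith-outside {L = (outside ∷ _) ∷ _}  (there T∈)    = there (∈-tailsWith-outside T∈)
∈-tailsWith-outside {L = (inside ∷ _) ∷ _}   (there T∈)    = ∈-tailsWith-outside T∈

∈-tailsWith-inside : ∀ {m} {T : Subset m} {L} → (inside ∷ T) ∈ L → T ∈ tailsWith inside L
∈-tailsWith-inside                          (here ≡.refl) = here ≡.refl
∈-tailsWith-inside {L = (outside ∷ _) ∷ _}  (there T∈)    = ∈-tailsWith-inside T∈
∈-tailsWith-inside {L = (inside ∷ _) ∷ _}   (there T∈)    = there (∈-tailsWith-inside T∈)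

open Annihilator

annihilator-[] : ∀ β → Annihilator [] [] β
annihilator-[] β .coeff _       = + β
annihilator-[] β .leading       = ≡.refl
annihilator-[] β .bounded []    = ℕ.≤-refl
annihilator-[] β .annihilates ()

-- The polynomial does not involve the first variable, so only the tails of the sets in `L` matter.
annihilator-outside : ∀ {m} {L : List (Subset (suc m))} {S β} →
  Annihilator (map tail L) S β → Annihilator L (outside ∷ S) β
annihilator-outside {m} 𝒜 .coeff (outside ∷ R)   = 𝒜 .coeff R
annihilator-outside {m} 𝒜 .coeff (inside ∷ R)    = 0ℤ
annihilator-outside {m} 𝒜 .leading               = 𝒜 .leading
annihilator-outside {m} 𝒜 .bounded (outside ∷ R) = 𝒜 .bounded R
annihilator-outside {m} 𝒜 .bounded (inside ∷ R)  = z≤n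
annihilator-outside {m} 𝒜 .annihilates {t ∷ T} T∈L = ≡.trans (ℤΣ.sum-allSubsets-suc m _)
  (≡.cong₂ ℤ._+_ (𝒜 .annihilates (∈-map⁺ tail T∈L))
                 (ℤΣ.sum-ε (allSubsets m) (λ R → ℤΣ.[]·-ε (not (meets (inside ∷ R) (t ∷ T))))))

-- The factor y is 0 on sets containing the first element, so the other factors need to vanish only
-- on the sets omitting it.
annihilator-·y : ∀ {m} {L : List (Subset (suc m))} {S β} →
  Annihilator (tailsWith outside L) S β → Annihilator L (inside ∷ S) β
annihilator-·y {m} 𝒜 .coeff (outside ∷ R)   = 0ℤ
annihilator-·y {m} 𝒜 .coeff (inside ∷ R)    = 𝒜 .coeff R
annihilator-·y {m} 𝒜 .leading               = 𝒜 .leading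
annihilator-·y {m} 𝒜 .bounded (outside ∷ R) = z≤n
annihilator-·y {m} 𝒜 .bounded (inside ∷ R)  = 𝒜 .bounded R
annihilator-·y {m} 𝒜 .annihilates {outside ∷ T} T∈L = ≡.trans (ℤΣ.sum-allSubsets-suc m _)
  (≡.cong₂ ℤ._+_ (ℤΣ.sum-ε (allSubsets m) (λ R → ℤΣ.[]·-ε (not (meets R T))))
                 (𝒜 .annihilates (∈-tailsWith-outside T∈L)))
annihilator-·y {m} 𝒜 .annihilates {inside ∷ T} T∈L = ≡.trans (ℤΣ.sum-allSubsets-suc m _)
  (≡.cong₂ ℤ._+_ (ℤΣ.sum-ε (allSubsets m) (λ R → ℤΣ.[]·-ε (not (meets R T))))
                 (ℤΣ.sum-ε (allSubsets m) (λ _ → ≡.refl)))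

-- The factor y - 1 is 0 on sets omitting the first element. Expanding the product gives each old
-- coefficient twice, with opposite signs, so the bound on absolute values persists.
annihilator-·[y-1] : ∀ {m} {L : List (Subset (suc m))} {S β} →
  Annihilator (tailsWith inside L) S β → Annihilator L (inside ∷ S) β
annihilator-·[y-1] {m} 𝒜 .coeff (outside ∷ R)   = ℤ.- 𝒜 .coeff R
annihilator-·[y-1] {m} 𝒜 .coeff (inside ∷ R)    = 𝒜 .coeff R
annihilator-·[y-1] {m} 𝒜 .leading               = 𝒜 .leading
annihilator-·[y-1] {m} 𝒜 .bounded (outside ∷ R) =
  ℕ.≤-trans (ℕ.≤-reflexive (ℤ.∣-i∣≡∣i∣ (𝒜 .coeff R))) (𝒜 .bounded R)
annihilator-·[y-1] {m} 𝒜 .bounded (inside ∷ R)  = 𝒜 .bounded R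
annihilator-·[y-1] {m} 𝒜 .annihilates {t ∷ T} T∈L = ≡.trans (ℤΣ.sum-allSubsets-suc m _)
  (≡.trans (≡.cong (λ x → x ℤ.+ total) negated) (cases t T∈L))
  where
  reduced total : ℤ
  reduced = ℤΣ.sum (allSubsets m) (λ R → ℤΣ.[ not (meets R T) ]· 𝒜 .coeff R)
  total = ℤΣ.sum (allSubsets m) (λ R → ℤΣ.[ not (meets (inside ∷ R) (t ∷ T)) ]· 𝒜 .coeff R)
  negated : ℤΣ.sum (allSubsets m) (λ R → ℤΣ.[ not (meets R T) ]· (ℤ.- 𝒜 .coeff R)) ≡ ℤ.- reduced
  negated = ≡.trans (ℤΣ.sum-cong (allSubsets m) (λ R → ℤInversion.[]·-⁻¹ (not (meets R T)) _))
                    (ℤInversion.sum-⁻¹ (allSubsets m) _)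
  cases : ∀ t → (t ∷ T) ∈ _ → ℤ.- reduced ℤ.+
    ℤΣ.sum (allSubsets m) (λ R → ℤΣ.[ not (meets (inside ∷ R) (t ∷ T)) ]· 𝒜 .coeff R) ≡ 0ℤ
  -- Here y = 1 and the two copies cancel; in the next case y = 0 and only the negated copy
  -- survives.
  cases outside T∈L = ℤ.+-inverseˡ reduced
  cases inside  T∈L = ≡.cong₂ ℤ._+_ (≡.cong ℤ.-_ (𝒜 .annihilates (∈-tailsWith-inside T∈L)))
                                    (ℤΣ.sum-ε (allSubsets m) (λ _ → ≡.refl))

-- The missing pattern is chosen greedily: at each element of S, keep whichever of the two halves
-- T ∌ i, T ∋ i of the family is small, and let the factor y_i or y_i - 1, respectively, kill the other.
annihilator : ∀ {m} (L : List (Subset m)) S β → length L < 2 ^ ∣ S ∣ → Annihilator L S β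
annihilator []      []            β L<         = annihilator-[] β
annihilator (_ ∷ L) []            β (s≤s ())
annihilator L       (outside ∷ S) β L<         = annihilator-outside
  (annihilator (map tail L) S β (≡.subst (_< 2 ^ ∣ S ∣) (≡.sym (length-map tail L)) L<))
annihilator L       (inside ∷ S)  β L<
  with length (tailsWith outside L) ℕ.<? 2 ^ ∣ S ∣ | length (tailsWith inside L) ℕ.<? 2 ^ ∣ S ∣
... | yes L₀< | _       = annihilator-·y (annihilator _ S β L₀<)
... | no _    | yes L₁< = annihilator-·[y-1] (annihilator _ S β L₁<)
... | no L₀≮  | no L₁≮  = contradiction L< (ℕ.≤⇒≯ (begin
  2 ^ ∣ S ∣ + (2 ^ ∣ S ∣ + 0)  ≡⟨ ≡.cong (λ x → 2 ^ ∣ S ∣ + x) (ℕ.+-identityʳ _) ⟩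
  2 ^ ∣ S ∣ + 2 ^ ∣ S ∣        ≤⟨ ℕ.+-mono-≤ (ℕ.≮⇒≥ L₀≮) (ℕ.≮⇒≥ L₁≮) ⟩
  length (tailsWith outside L) + length (tailsWith inside L) ≡⟨ length-tailsWith L ⟩
  length L                     ∎))
  where open ℕ.≤-Reasoning

-- Integer sums and inequalities

sum-+ : ∀ {a} {A : Set a} (xs : List A) f → + ℕΣ.sum xs f ≡ ℤΣ.sum xs (λ x → + f x)
sum-+ []       f = ≡.refl
sum-+ (x ∷ xs) f = ≡.trans (ℤ.pos-+ (f x) _) (≡.cong (λ s → + f x ℤ.+ s) (sum-+ xs f))

sum-nonneg : ∀ {a} {A : Set a} (xs : List A) {f} → (∀ x → 0ℤ ℤ.≤ f x) → 0ℤ ℤ.≤ ℤΣ.sum xs f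
sum-nonneg []       0≤f = ℤ.≤-refl
sum-nonneg (x ∷ xs) 0≤f = ℤ.+-mono-≤ (0≤f x) (sum-nonneg xs 0≤f)

term≤sum : ∀ {a} {A : Set a} {xs : List A} {f x} → (∀ x → 0ℤ ℤ.≤ f x) → x ∈ xs → f x ℤ.≤ ℤΣ.sum xs f
term≤sum {xs = xs} {f} {x} 0≤f (here {xs = ys} ≡.refl) =
  ≡.subst (ℤ._≤ ℤΣ.sum xs f) (ℤ.+-identityʳ (f x)) (ℤ.+-monoʳ-≤ (f x) (sum-nonneg ys 0≤f))
term≤sum {xs = xs} {f} {x} 0≤f (there {x = y} x∈ys)    =
  ≡.subst (ℤ._≤ ℤΣ.sum xs f) (ℤ.+-identityˡ (f x)) (ℤ.+-mono-≤ (0≤f y) (term≤sum 0≤f x∈ys))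

∣i∣≤n⇒0≤i+n : ∀ i {n} → ℤ.∣ i ∣ ≤ n → 0ℤ ℤ.≤ i ℤ.+ + n
∣i∣≤n⇒0≤i+n (+ _)        _    = ℤ.+≤+ z≤n
∣i∣≤n⇒0≤i+n ℤ.-[1+ _ ] i≤n = ≡.subst (0ℤ ℤ.≤_) (≡.sym (ℤ.⊖-≥ i≤n)) (ℤ.+≤+ z≤n)

n≤i+n⇒0≤i : ∀ {i} n → n ℤ.≤ i ℤ.+ n → 0ℤ ℤ.≤ i
n≤i+n⇒0≤i {i} n n≤i+n = ≡.subst₂ ℤ._≤_ (ℤ.+-inverseʳ n) (//-rightDividesʳ n i)
  (ℤ.+-monoˡ-≤ (ℤ.- n) n≤i+n)
  where open AbelianGroupProperties ℤ.+-0-abelianGroup using (//-rightDividesʳ)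

-- Correcting the weights to nonnegative ones

-- The empty set also receives `N`, so that the nonnegativity bound holds for every set without
-- exception.
baseWeight : ∀ {m} → ℕ → ℕ → Subset m → ℤ
baseWeight k N S with k ℕ.<? ∣ S ∣
... | yes _ = -1ℤ
... | no  _ = + N

module Correction {m} (k : ℕ) (L : List (Subset m)) (L≤ : length L ≤ 2 ^ k) where

  -- At most `2 ^ k` sets cannot realise all `2 ^ ∣ S ∣` traces on a set `S` with more than `k`
  -- elements.
  relation : ∀ S → k < ∣ S ∣ → Annihilator L S (cost S)
  relation S k<S = annihilator L S (cost S)
    (ℕ.≤-<-trans L≤ (ℕ.^-monoʳ-< 2 (s≤s (s≤s z≤n)) k<S))

  -- The first argument is the set whose relation is used, the second the set whose weight it
  -- changes.
  correction : Subset m → Subset m → ℤ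
  correction S R with k ℕ.<? ∣ S ∣
  ... | yes k<S = relation S k<S .coeff R
  ... | no  _   = 0ℤ

  correction-bounded : ∀ S R → ℤ.∣ correction S R ∣ ≤ ℕΣ.[ R ⊆ᵇ S ]· cost S
  correction-bounded S R with k ℕ.<? ∣ S ∣
  ... | yes k<S = relation S k<S .bounded R
  ... | no  _   = z≤n

  correction-annihilates : ∀ S {T} → T ∈ L →
    ℤΣ.sum (allSubsets m) (λ R → ℤΣ.[ not (meets R T) ]· correction S R) ≡ 0ℤ
  correction-annihilates S {T} T∈L with k ℕ.<? ∣ S ∣
  ... | yes k<S = relation S k<S .annihilates T∈L
  ... | no  _   = ℤΣ.sum-ε (allSubsets m) (λ R → ℤΣ.[]·-ε (not (meets R T)))

  totalCorrection : Subset m → ℤ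
  totalCorrection R = ℤΣ.sum (allSubsets m) (λ S → correction S R)

  -- The relation kills the sum over `R` disjoint from `T`. At `T = ⊥` that is the sum over all `R`,
  -- so the complementary sum, over `R` meeting `T`, vanishes too. This is why `⊥` belongs to `L`.
  correction-meets : ⊥ ∈ L → ∀ S {T} → T ∈ L →
    ℤΣ.sum (allSubsets m) (λ R → ℤΣ.[ meets R T ]· correction S R) ≡ 0ℤ
  correction-meets ⊥∈L S {T} T∈L = begin
    sumOf (λ R → meets R T)                                   ≡⟨ ℤ.+-identityʳ _ ⟨
    sumOf (λ R → meets R T) ℤ.+ 0ℤ
      ≡⟨ ≡.cong (λ x → sumOf (λ R → meets R T) ℤ.+ x) (correction-annihilates S T∈L) ⟨
    sumOf (λ R → meets R T) ℤ.+ sumOf (λ R → not (meets R T)) ≡⟨ ℤΣ.sum-∙ (allSubsets m) _ _ ⟨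
    ℤΣ.sum (allSubsets m) (λ R → ℤΣ.[ meets R T ]· correction S R ℤ.+ ℤΣ.[ not (meets R T) ]· correction S R)
      ≡⟨ ℤΣ.sum-cong (allSubsets m) (λ R → ℤΣ.[]·-not (meets R T) (correction S R)) ⟩
    ℤΣ.sum (allSubsets m) (correction S)
      ≡⟨ ℤΣ.sum-cong (allSubsets m) (λ R →
           ≡.cong (λ b → ℤΣ.[ not b ]· correction S R) (≡.sym (meets-⊥ R))) ⟩
    sumOf (λ R → not (meets R ⊥))                             ≡⟨ correction-annihilates S ⊥∈L ⟩
    0ℤ ∎
    where
    open ≡.≡-Reasoning
    sumOf : (Subset m → Bool) → ℤ
    sumOf p = ℤΣ.sum (allSubsets m) (λ R → ℤΣ.[ p R ]· correction S R)

  -- After the two sums are exchanged, each relation contributes zero on its own.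
  corrected-agrees : ⊥ ∈ L → ∀ (w : Subset m → ℤ) {T} → T ∈ L →
    ℤΣ.sum (allSubsets m) (λ R → ℤΣ.[ meets R T ]· (w R ℤ.+ totalCorrection R)) ≡
    ℤΣ.sum (allSubsets m) (λ R → ℤΣ.[ meets R T ]· w R)
  corrected-agrees ⊥∈L w {T} T∈L = begin
    ℤΣ.sum (allSubsets m) (λ R → ℤΣ.[ meets R T ]· (w R ℤ.+ totalCorrection R))
      ≡⟨ ℤΣ.sum-cong (allSubsets m) (λ R → ℤΣ.[]·-∙ (meets R T) (w R) (totalCorrection R)) ⟩
    ℤΣ.sum (allSubsets m) (λ R → ℤΣ.[ meets R T ]· w R ℤ.+ ℤΣ.[ meets R T ]· totalCorrection R)
      ≡⟨ ℤΣ.sum-∙ (allSubsets m) _ _ ⟩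
    V ℤ.+ ℤΣ.sum (allSubsets m) (λ R → ℤΣ.[ meets R T ]· totalCorrection R)
      ≡⟨ ≡.cong (λ x → V ℤ.+ x) (ℤΣ.sum-cong (allSubsets m) (λ R → ℤΣ.[]·-sum (meets R T) (allSubsets m) _)) ⟩
    V ℤ.+ ℤΣ.sum (allSubsets m) (λ R → ℤΣ.sum (allSubsets m) (λ S → ℤΣ.[ meets R T ]· correction S R))
      ≡⟨ ≡.cong (λ x → V ℤ.+ x) (ℤΣ.sum-swap (allSubsets m) (allSubsets m) _) ⟩
    V ℤ.+ ℤΣ.sum (allSubsets m) (λ S → ℤΣ.sum (allSubsets m) (λ R → ℤΣ.[ meets R T ]· correction S R))
      ≡⟨ ≡.cong (λ x → V ℤ.+ x) (ℤΣ.sum-ε (allSubsets m) (λ S → correction-meets ⊥∈L S T∈L)) ⟩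
    V ℤ.+ 0ℤ  ≡⟨ ℤ.+-identityʳ V ⟩
    V ∎
    where
    open ≡.≡-Reasoning
    V : ℤ
    V = ℤΣ.sum (allSubsets m) (λ R → ℤΣ.[ meets R T ]· w R)

  -- Adding `cost S` for every `S` containing `R` makes all summands nonnegative, so their sum is at
  -- least the single summand at `S = R`.
  totalCorrection-≥ : ∀ R →
    correction R R ℤ.+ + cost R ℤ.≤ totalCorrection R ℤ.+ + supersetCost R
  totalCorrection-≥ R = begin
    correction R R ℤ.+ + cost R
      ≡⟨ ≡.cong (λ b → correction R R ℤ.+ + (ℕΣ.[ b ]· cost R)) (⊆ᵇ-refl R) ⟨
    correction R R ℤ.+ + (ℕΣ.[ R ⊆ᵇ R ]· cost R)
      ≤⟨ term≤sum (λ S → ∣i∣≤n⇒0≤i+n (correction S R) (correction-bounded S R)) (∈-allSubsets R) ⟩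
    ℤΣ.sum (allSubsets m) (λ S → correction S R ℤ.+ + (ℕΣ.[ R ⊆ᵇ S ]· cost S))
      ≡⟨ ℤΣ.sum-∙ (allSubsets m) _ _ ⟩
    totalCorrection R ℤ.+ ℤΣ.sum (allSubsets m) (λ S → + (ℕΣ.[ R ⊆ᵇ S ]· cost S))
      ≡⟨ ≡.cong (λ x → totalCorrection R ℤ.+ x) (sum-+ (allSubsets m) _) ⟨
    totalCorrection R ℤ.+ + supersetCost R ∎
    where open ℤ.≤-Reasoning

  base-correction-≥ : ∀ {N} → (2 ^ m) ! < N → ∀ R →
    + supersetCost R ℤ.≤ baseWeight k N R ℤ.+ (correction R R ℤ.+ + cost R)
  base-correction-≥ {N} N> R with k ℕ.<? ∣ R ∣
  -- The leading coefficient supplies a second `cost R`, and the strict bound absorbs the -1.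
  ... | yes k<R rewrite relation R k<R .leading =
    ℤ.≤-trans (ℤ.+≤+ (ℕ.<⇒≤pred (supersetCost-< R)))
      (ℤ.≤-reflexive (pred-pos (cost R + cost R) (ℕ.≤-<-trans z≤n (supersetCost-< R))))
    where
    pred-pos : ∀ n → 0 < n → + pred n ≡ -1ℤ ℤ.+ + n
    pred-pos (suc n) _ = ≡.refl
  -- No relation is attached to a small set; `N`, which exceeds every cost, takes the place of the
  -- second `cost R`.
  ... | no  _   = ℤ.+≤+ (ℕ.<⇒≤ (ℕ.<-≤-trans (supersetCost-< R)
                    (ℕ.+-monoˡ-≤ (cost R) (ℕ.≤-trans (cost-≤ R) (ℕ.<⇒≤ N>)))))

  corrected-nonneg : ∀ {N} → (2 ^ m) ! < N → ∀ R →
    0ℤ ℤ.≤ baseWeight k N R ℤ.+ totalCorrection R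
  corrected-nonneg {N} N> R = n≤i+n⇒0≤i (+ supersetCost R) (begin
    + supersetCost R                                            ≤⟨ base-correction-≥ N> R ⟩
    baseWeight k N R ℤ.+ (correction R R ℤ.+ + cost R)
      ≤⟨ ℤ.+-monoʳ-≤ (baseWeight k N R) (totalCorrection-≥ R) ⟩
    baseWeight k N R ℤ.+ (totalCorrection R ℤ.+ + supersetCost R)
      ≡⟨ ℤ.+-assoc (baseWeight k N R) _ _ ⟨
    baseWeight k N R ℤ.+ totalCorrection R ℤ.+ + supersetCost R ∎)
    where open ℤ.≤-Reasoning

-- The additive group of Cauchy reals

0<½*ε : ∀ {ε} → 0ℚ ℚ.< ε → 0ℚ ℚ.< ½ ℚ.* ε
0<½*ε {ε} 0<ε = ≡.subst (ℚ._< ½ ℚ.* ε) (ℚ.*-zeroʳ ½) (ℚ.*-monoʳ-<-pos ½ 0<ε)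

½*ε+½*ε≡ε : ∀ ε → ½ ℚ.* ε ℚ.+ ½ ℚ.* ε ≡ ε
½*ε+½*ε≡ε ε = ≡.trans (≡.sym (ℚ.*-distribʳ-+ ε ½ ½)) (ℚ.*-identityˡ ε)

≡⇒≈ : ∀ {x y} → (∀ i → seq x i ≡ seq y i) → x ≈ y
≡⇒≈ {x} {y} x≡y ε 0<ε = 0 , λ i _ → ≡.subst (ℚ._< ε)
  (≡.sym (≡.cong ℚ.∣_∣ (≡.trans (≡.cong (ℚ._- seq y i) (x≡y i)) (ℚ.+-inverseʳ (seq y i))))) 0<ε

≈-sym : ∀ {x y} → x ≈ y → y ≈ x
≈-sym {x} {y} x≈y ε 0<ε = map₂ (λ p i i≥ → ≡.subst (ℚ._< ε) (∣p-q∣≡∣q-p∣ (seq x i) (seq y i)) (p i i≥)) (x≈y ε 0<ε)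
  where
  ∣p-q∣≡∣q-p∣ : ∀ p q → ℚ.∣ p ℚ.- q ∣ ≡ ℚ.∣ q ℚ.- p ∣
  ∣p-q∣≡∣q-p∣ p q = ≡.trans (≡.sym (ℚ.∣-p∣≡∣p∣ (p ℚ.- q)))
    (≡.cong ℚ.∣_∣ (solve 2 (λ p q → :- (p :- q) := q :- p) ≡.refl p q))
    where open +-*-Solver

-- The common ε/2 argument behind transitivity and the congruence of addition.
≈-combine : ∀ {x y x′ y′ z t} →
  (∀ i → seq z i ℚ.- seq t i ≡ (seq x i ℚ.- seq y i) ℚ.+ (seq x′ i ℚ.- seq y′ i)) →
  x ≈ y → x′ ≈ y′ → z ≈ t
≈-combine {x} {y} {x′} {y′} split x≈y x′≈y′ ε 0<ε =
  let n₁ , p₁ = x≈y   (½ ℚ.* ε) (0<½*ε 0<ε)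
      n₂ , p₂ = x′≈y′ (½ ℚ.* ε) (0<½*ε 0<ε)
  in n₁ ⊔ n₂ , λ i i≥ → ≡.subst (λ d → ℚ.∣ d ∣ ℚ.< ε) (≡.sym (split i))
       (ℚ.≤-<-trans (ℚ.∣p+q∣≤∣p∣+∣q∣ (seq x i ℚ.- seq y i) (seq x′ i ℚ.- seq y′ i))
         (≡.subst (ℚ.∣ seq x i ℚ.- seq y i ∣ ℚ.+ ℚ.∣ seq x′ i ℚ.- seq y′ i ∣ ℚ.<_) (½*ε+½*ε≡ε ε)
           (ℚ.+-mono-< (p₁ i (ℕ.m⊔n≤o⇒m≤o n₁ n₂ i≥)) (p₂ i (ℕ.m⊔n≤o⇒n≤o n₁ n₂ i≥)))))

≈-trans : ∀ {x y z} → x ≈ y → y ≈ z → x ≈ z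
≈-trans {x} {y} {z} = ≈-combine {x} {y} {y} {z} {x} {z} λ i →
  solve 3 (λ p q r → p :- r := (p :- q) :+ (q :- r)) ≡.refl (seq x i) (seq y i) (seq z i)
  where open +-*-Solver

+ᴿ-cong : ∀ {x y x′ y′} → x ≈ y → x′ ≈ y′ → x +ᴿ x′ ≈ y +ᴿ y′
+ᴿ-cong {x} {y} {x′} {y′} = ≈-combine {x} {y} {x′} {y′} {x +ᴿ x′} {y +ᴿ y′} λ i →
  solve 4 (λ p q p′ q′ → (p :+ p′) :- (q :+ q′) := (p :- q) :+ (p′ :- q′)) ≡.refl
    (seq x i) (seq y i) (seq x′ i) (seq y′ i)
  where open +-*-Solver

-ᴿ-cong : ∀ {x y} → x ≈ y → -ᴿ x ≈ -ᴿ y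
-ᴿ-cong {x} {y} x≈y ε 0<ε = map₂
  (λ p i i≥ → ≡.subst (ℚ._< ε) (∣p-q∣≡∣-p--q∣ (seq x i) (seq y i)) (p i i≥)) (x≈y ε 0<ε)
  where
  ∣p-q∣≡∣-p--q∣ : ∀ p q → ℚ.∣ p ℚ.- q ∣ ≡ ℚ.∣ ℚ.- p ℚ.- (ℚ.- q) ∣
  ∣p-q∣≡∣-p--q∣ p q = ≡.trans (≡.sym (ℚ.∣-p∣≡∣p∣ (p ℚ.- q)))
    (≡.cong ℚ.∣_∣ (ℚ.neg-distrib-+ p (ℚ.- q)))

ℝ-+-abelianGroup : AbelianGroup _ _
ℝ-+-abelianGroup = record
  { Carrier = ℝ ; _≈_ = _≈_ ; _∙_ = _+ᴿ_ ; ε = 0ᴿ ; _⁻¹ = -ᴿ_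
  ; isAbelianGroup = record
    { isGroup = record
      { isMonoid = record
        { isSemigroup = record
          { isMagma = record
            { isEquivalence = record
              { refl  = λ {x} → ≡⇒≈ {x} {x} (λ _ → ≡.refl)
              ; sym   = λ {x} {y} → ≈-sym {x} {y}
              ; trans = λ {x} {y} {z} → ≈-trans {x} {y} {z}
              }
            ; ∙-cong = λ {x} {y} {x′} {y′} → +ᴿ-cong {x} {y} {x′} {y′}
            }
          ; assoc = λ x y z → ≡⇒≈ {x +ᴿ y +ᴿ z} {x +ᴿ (y +ᴿ z)} λ i → ℚ.+-assoc (seq x i) (seq y i) (seq z i)
          }
        ; identity = (λ x → ≡⇒≈ {0ᴿ +ᴿ x} {x} λ i → ℚ.+-identityˡ (seq x i))
                   , (λ x → ≡⇒≈ {x +ᴿ 0ᴿ} {x} λ i → ℚ.+-identityʳ (seq x i))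
        }
      ; inverse = (λ x → ≡⇒≈ { -ᴿ x +ᴿ x} {0ᴿ} λ i → ℚ.+-inverseˡ (seq x i))
                , (λ x → ≡⇒≈ {x +ᴿ -ᴿ x} {0ᴿ} λ i → ℚ.+-inverseʳ (seq x i))
      ; ⁻¹-cong = λ {x} {y} → -ᴿ-cong {x} {y}
      }
    ; comm = λ x y → ≡⇒≈ {x +ᴿ y} {y +ᴿ x} λ i → ℚ.+-comm (seq x i) (seq y i)
    }
  }

module ℝ+ = AbelianGroup ℝ-+-abelianGroup
module ℝΣ = Sum ℝ+.commutativeMonoid
module ℝInversion = Inversion ℝ-+-abelianGroup

-- Transfer of integer sums and coefficients to the reals

-- In unnormalised rationals both sides have denominator 1, which leaves an identity of integers.
/1-+ : ∀ a b → (a ℤ.+ b) ℚ./ 1 ≡ a ℚ./ 1 ℚ.+ b ℚ./ 1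
/1-+ a b = ℚ.toℚᵘ-injective (begin
  ℚ.toℚᵘ (ℚ.fromℚᵘ (mkℚᵘ (a ℤ.+ b) 0))         ≈⟨ ℚ.toℚᵘ-fromℚᵘ (mkℚᵘ (a ℤ.+ b) 0) ⟩
  mkℚᵘ (a ℤ.+ b) 0
    ≈⟨ ℚᵘ.*≡* (≡.cong (ℤ._* + 1) (≡.sym (≡.cong₂ ℤ._+_ (ℤ.*-identityʳ a) (ℤ.*-identityʳ b)))) ⟩
  mkℚᵘ a 0 ℚᵘ.+ mkℚᵘ b 0
    ≈⟨ ℚᵘ.+-cong (ℚ.toℚᵘ-fromℚᵘ (mkℚᵘ a 0)) (ℚ.toℚᵘ-fromℚᵘ (mkℚᵘ b 0)) ⟨
  ℚ.toℚᵘ (a ℚ./ 1) ℚᵘ.+ ℚ.toℚᵘ (b ℚ./ 1)       ≈⟨ ℚ.toℚᵘ-homo-+ (a ℚ./ 1) (b ℚ./ 1) ⟨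
  ℚ.toℚᵘ (a ℚ./ 1 ℚ.+ b ℚ./ 1)                 ∎)
  where open SetoidReasoning ℚᵘ.≃-setoid

fromℤ-sum : ∀ {a} {A : Set a} (xs : List A) f → fromℤ (ℤΣ.sum xs f) ≈ ℝΣ.sum xs (λ x → fromℤ (f x))
fromℤ-sum []       f = ℝ+.refl {0ᴿ}
fromℤ-sum (x ∷ xs) f = ≈-trans {fromℤ (ℤΣ.sum (x ∷ xs) f)} {fromℤ (f x) +ᴿ fromℤ (ℤΣ.sum xs f)}
    {ℝΣ.sum (x ∷ xs) (λ x → fromℤ (f x))}
  (≡⇒≈ {fromℤ (ℤΣ.sum (x ∷ xs) f)} {fromℤ (f x) +ᴿ fromℤ (ℤΣ.sum xs f)} (λ _ → /1-+ (f x) (ℤΣ.sum xs f)))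
  (ℝ+.∙-congˡ {fromℤ (f x)} {fromℤ (ℤΣ.sum xs f)} {ℝΣ.sum xs (λ x → fromℤ (f x))} (fromℤ-sum xs f))

fromℕ : ℕ → ℝ≥0
fromℕ n = mkℝ≥0 (fromℤ (+ n)) λ ε 0<ε → 0 , λ _ _ →
  ℚ.+-mono-≤-< (ℚ.nonNegative⁻¹ (+ n ℚ./ 1) {{ℚ.normalize-nonNeg n 1}}) 0<ε

∑≡sum : ∀ {a} {A : Set a} (xs : List A) f → ∑ xs f ≡ ℝΣ.sum xs f
∑≡sum []       f = ≡.refl
∑≡sum (x ∷ xs) f = ≡.cong (f x +ᴿ_) (∑≡sum xs f)

sign≡alternate : ∀ n x → sign n x ≡ ℝInversion.alternate n x
sign≡alternate zero    x = ≡.refl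
sign≡alternate (suc n) x = ≡.cong -ᴿ_ (sign≡alternate n x)

wCoeff≈W : ∀ {m} (f : Subset m → ℝ) S → wCoeff f S ≈ ℝInversion.W f S
wCoeff≈W {m} f S = begin
  wCoeff f S
    ≡⟨ ∑≡sum (filter (λ T → ≡-dec _≟ᵇ_ (S ∪ T) ⊤) (allSubsets m)) _ ⟩
  ℝΣ.sum (filter (λ T → ≡-dec _≟ᵇ_ (S ∪ T) ⊤) (allSubsets m)) (λ T → sign (suc ∣ S Subset.∩ T ∣) (f T))
    ≈⟨ ℝΣ.sum-filter (λ T → ≡-dec _≟ᵇ_ (S ∪ T) ⊤) (allSubsets m) _ ⟩
  ℝΣ.sum (allSubsets m) (λ T → ℝΣ.[ covers S T ]· sign (suc ∣ S Subset.∩ T ∣) (f T))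
    ≈⟨ ℝΣ.sum-cong (allSubsets m) (λ T → ℝ+.reflexive
         (≡.cong (ℝΣ.[ covers S T ]·_) (sign≡alternate (suc ∣ S Subset.∩ T ∣) (f T)))) ⟩
  ℝInversion.W f S ∎
  where open SetoidReasoning ℝ+.setoid

-- Coverage functions from weights on all subsets

meets-reflects : ∀ {m} (S T : Subset m) → Reflects (∃ λ i → i Subset.∈ S × i Subset.∈ T) (meets S T)
meets-reflects []            []            = ofⁿ λ ()
meets-reflects (inside ∷ S)  (inside ∷ T)  = ofʸ (zero , here , here)
meets-reflects (outside ∷ S) (t ∷ T)       with meets S T | meets-reflects S T
... | true  | ofʸ (i , i∈S , i∈T) = ofʸ (suc i , there i∈S , there i∈T)
... | false | ofⁿ ∄i              = ofⁿ λ { (suc i , there i∈S , there i∈T) → ∄i (i , i∈S , i∈T) }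
meets-reflects (inside ∷ S)  (outside ∷ T) with meets S T | meets-reflects S T
... | true  | ofʸ (i , i∈S , i∈T) = ofʸ (suc i , there i∈S , there i∈T)
... | false | ofⁿ ∄i              = ofⁿ λ { (suc i , there i∈S , there i∈T) → ∄i (i , i∈S , i∈T) }

∈-⋃⁺ : ∀ {n} {A : Set} (V : A → Subset n) {xs x u} → x ∈ xs → u Subset.∈ V x → u Subset.∈ ⋃ (map V xs)
∈-⋃⁺ V (here ≡.refl) u∈ = x∈p∪q⁺ (inj₁ u∈)
∈-⋃⁺ V (there x∈xs)  u∈ = x∈p∪q⁺ (inj₂ (∈-⋃⁺ V x∈xs u∈))

∈-⋃⁻ : ∀ {n} {A : Set} (V : A → Subset n) xs {u} → u Subset.∈ ⋃ (map V xs) → ∃ λ x → x ∈ xs × u Subset.∈ V x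
∈-⋃⁻ V []       u∈ = contradiction u∈ ∉⊥
∈-⋃⁻ V (x ∷ xs) u∈ with x∈p∪q⁻ (V x) _ u∈
... | inj₁ u∈V = x , here ≡.refl , u∈V
... | inj₂ u∈⋃ with ∈-⋃⁻ V xs u∈⋃
...   | y , y∈xs , u∈V = y , there y∈xs , u∈V

-- Transposes the incidence matrix: the sets `F u` of indices become the sets `A_i` of ground
-- elements.
transpose : ∀ {m n} → (Fin n → Subset m) → Fin m → Subset n
transpose F i = Vec.tabulate (λ u → Vec.lookup (F u) i)

∈-transpose⁺ : ∀ {m n} (F : Fin n → Subset m) {i u} → i Subset.∈ F u → u Subset.∈ transpose F i
∈-transpose⁺ F {i} {u} i∈ = lookup⇒[]= u _ (≡.trans (lookup∘tabulate _ u) ([]=⇒lookup i∈))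

∈-transpose⁻ : ∀ {m n} (F : Fin n → Subset m) {i u} → u Subset.∈ transpose F i → i Subset.∈ F u
∈-transpose⁻ F {i} {u} u∈ = lookup⇒[]= i _ (≡.trans (≡.sym (lookup∘tabulate _ u)) ([]=⇒lookup u∈))

-- The reflected proposition is the one that `meets-reflects` treats, so `det` identifies the two
-- Booleans.
union-reflects : ∀ {m n} (F : Fin n → Subset m) T u →
  Reflects (∃ λ i → i Subset.∈ F u × i Subset.∈ T) (does (u ∈? ⋃ (map (transpose F) (elements T))))
union-reflects F T u with u ∈? ⋃ (map (transpose F) (elements T))
... | yes u∈ = ofʸ (let i , i∈ , u∈Aᵢ = ∈-⋃⁻ (transpose F) (elements T) u∈
                    in i , ∈-transpose⁻ F u∈Aᵢ , proj₂ (∈-filter⁻ (_∈? T) {xs = allFin _} i∈))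
... | no  u∉ = ofⁿ λ (i , i∈F , i∈T) →
  u∉ (∈-⋃⁺ (transpose F) (∈-filter⁺ (_∈? T) (∈-allFin i) i∈T) (∈-transpose⁺ F i∈F))

sum-union : ∀ {m n} (F : Fin n → Subset m) (w : Fin n → ℝ) T →
  ∑ (elements (⋃ (map (transpose F) (elements T)))) w ≈
  ℝΣ.sum (allFin n) (λ u → ℝΣ.[ meets (F u) T ]· w u)
sum-union {n = n} F w T = begin
  ∑ (elements ⋃A) w          ≡⟨ ∑≡sum (elements ⋃A) w ⟩
  ℝΣ.sum (elements ⋃A) w     ≈⟨ ℝΣ.sum-filter (_∈? ⋃A) (allFin n) w ⟩
  ℝΣ.sum (allFin n) (λ u → ℝΣ.[ does (u ∈? ⋃A) ]· w u)
    ≈⟨ ℝΣ.sum-cong (allFin n) (λ u → ℝ+.reflexive (≡.cong (λ b → ℝΣ.[ b ]· w u)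
         (det (union-reflects F T u) (meets-reflects (F u) T)))) ⟩
  ℝΣ.sum (allFin n) (λ u → ℝΣ.[ meets (F u) T ]· w u) ∎
  where
  open SetoidReasoning ℝ+.setoid
  ⋃A : Subset n
  ⋃A = ⋃ (map (transpose F) (elements T))

fromℤ-[]· : ∀ b x → fromℤ (ℤΣ.[ b ]· x) ≡ ℝΣ.[ b ]· fromℤ x
fromℤ-[]· true  x = ≡.refl
fromℤ-[]· false x = ≡.refl

fromℤ-meets : ∀ {m} (w : Subset m → ℤ) T →
  fromℤ (ℤΣ.sum (allSubsets m) (λ S → ℤΣ.[ meets S T ]· w S)) ≈
  ℝΣ.sum (allSubsets m) (λ S → ℝΣ.[ meets S T ]· fromℤ (w S))
fromℤ-meets {m} w T = begin
  fromℤ (ℤΣ.sum (allSubsets m) (λ S → ℤΣ.[ meets S T ]· w S))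
    ≈⟨ fromℤ-sum (allSubsets m) _ ⟩
  ℝΣ.sum (allSubsets m) (λ S → fromℤ (ℤΣ.[ meets S T ]· w S))
    ≈⟨ ℝΣ.sum-cong (allSubsets m) (λ S → ℝ+.reflexive (fromℤ-[]· (meets S T) (w S))) ⟩
  ℝΣ.sum (allSubsets m) (λ S → ℝΣ.[ meets S T ]· fromℤ (w S)) ∎
  where open SetoidReasoning ℝ+.setoid

coverage : ∀ {m} → (Subset m → ℕ) → Subset m → ℝ≥0
coverage {m} w T = fromℕ (ℕΣ.sum (allSubsets m) (λ S → ℕΣ.[ meets S T ]· w S))

real-coverage : ∀ {m} (w : Subset m → ℕ) T →
  real (coverage w T) ≡ fromℤ (ℤΣ.sum (allSubsets m) (λ S → ℤΣ.[ meets S T ]· + w S))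
real-coverage {m} w T = ≡.cong fromℤ (≡.trans (sum-+ (allSubsets m) _)
  (ℤΣ.sum-cong (allSubsets m) (λ S → +-[]· (meets S T) (w S))))
  where
  +-[]· : ∀ b n → + (ℕΣ.[ b ]· n) ≡ ℤΣ.[ b ]· + n
  +-[]· true  n = ≡.refl
  +-[]· false n = ≡.refl

-- The ground set consists of the indices of all subsets S in allSubsets m, and Aᵢ of those with i ∈ S.
coverage-isCoverage : ∀ {m} (w : Subset m → ℕ) → IsCoverage (coverage w)
coverage-isCoverage {m} w = length (allSubsets m) , (λ u → fromℕ (w (F u))) , transpose F , λ T → begin
  real (coverage w T)
    ≡⟨ real-coverage w T ⟩
  fromℤ (ℤΣ.sum (allSubsets m) (λ S → ℤΣ.[ meets S T ]· + w S))
    ≈⟨ fromℤ-meets (λ S → + w S) T ⟩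
  ℝΣ.sum (allSubsets m) (λ S → ℝΣ.[ meets S T ]· fromℤ (+ w S))
    ≡⟨ ≡.cong (λ xs → ℝΣ.sum xs (λ S → ℝΣ.[ meets S T ]· fromℤ (+ w S)))
         (≡.trans (map-tabulate id F) (tabulate-lookup (allSubsets m))) ⟨
  ℝΣ.sum (map F (allFin _)) (λ S → ℝΣ.[ meets S T ]· fromℤ (+ w S))
    ≡⟨ ℝΣ.sum-map F (allFin _) _ ⟩
  ℝΣ.sum (allFin _) (λ u → ℝΣ.[ meets (F u) T ]· fromℤ (+ w (F u)))
    ≈⟨ sum-union F (λ u → fromℤ (+ w (F u))) T ⟨
  ∑ (elements (⋃ (map (transpose F) (elements T)))) (λ u → fromℤ (+ w (F u))) ∎
  where
  open SetoidReasoning ℝ+.setoid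
  F : Fin (length (allSubsets m)) → Subset m
  F = List.lookup (allSubsets m)

-- Values determined by the coefficients, and the theorem

prescribed-values : ∀ {m} (f : Subset m → ℝ) (w : Subset m → ℤ) → f ⊥ ≈ 0ᴿ →
  (∀ S → Nonempty S → wCoeff f S ≈ fromℤ (w S)) → ∀ T →
  f T ≈ fromℤ (ℤΣ.sum (allSubsets m) (λ S → ℤΣ.[ meets S T ]· w S))
prescribed-values {m} f w f⊥≈0 w≈ T = begin
  f T
    ≈⟨ ℝInversion.W-inversion f T ⟩
  f ⊥ +ᴿ ℝΣ.sum (allSubsets m) (λ S → ℝΣ.[ meets S T ]· ℝInversion.W f S)
    ≈⟨ ℝ+.∙-cong {f ⊥} {0ᴿ} {ℝΣ.sum (allSubsets m) (λ S → ℝΣ.[ meets S T ]· ℝInversion.W f S)} {V}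
         f⊥≈0 (ℝΣ.sum-cong (allSubsets m) term≈) ⟩
  0ᴿ +ᴿ ℝΣ.sum (allSubsets m) (λ S → ℝΣ.[ meets S T ]· fromℤ (w S))
    ≈⟨ ℝ+.identityˡ V ⟩
  ℝΣ.sum (allSubsets m) (λ S → ℝΣ.[ meets S T ]· fromℤ (w S))
    ≈⟨ fromℤ-meets w T ⟨
  fromℤ (ℤΣ.sum (allSubsets m) (λ S → ℤΣ.[ meets S T ]· w S)) ∎
  where
  open SetoidReasoning ℝ+.setoid
  V : ℝ
  V = ℝΣ.sum (allSubsets m) (λ S → ℝΣ.[ meets S T ]· fromℤ (w S))
  term≈ : ∀ S → ℝΣ.[ meets S T ]· ℝInversion.W f S ≈ ℝΣ.[ meets S T ]· fromℤ (w S)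
  term≈ S with meets S T | meets-reflects S T
  ... | false | _                 = ℝ+.refl {0ᴿ}
  -- A common element shows that `S` is nonempty, so its coefficient is among the prescribed ones.
  ... | true  | ofʸ (i , i∈S , _) = ℝ+.trans {ℝInversion.W f S} {wCoeff f S} {fromℤ (w S)}
    (ℝ+.sym {wCoeff f S} {ℝInversion.W f S} (wCoeff≈W f S)) (w≈ S (i , i∈S))

theorem3p1 : ∀ {ℓ} (k m : ℕ) → 1 ≤ k → k < m →
    (N : ℕ) → (2 ^ m) ! < N →
    (f* : Subset m → ℝ) →
    f* ⊥ ≈ 0ᴿ →
    (∀ S → Nonempty S → ∣ S ∣ ≤ k → wCoeff f* S ≈ fromℤ (+ N)) →
    (∀ S → k < ∣ S ∣ → wCoeff f* S ≈ fromℤ -1ℤ) →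
    (𝒥 : Pred (Subset m) ℓ) (𝒥? : Decidable 𝒥) → card 𝒥? < 2 ^ k →
    ∃ λ (f : Subset m → ℝ≥0) →
    IsCoverage f × (∀ T → 𝒥 T → real (f T) ≈ f* T)
theorem3p1 k m _ _ N N> f* f*⊥≈0 small large 𝒥 𝒥? 𝒥< =
  coverage w′ , coverage-isCoverage w′ , agrees
  where
  open SetoidReasoning ℝ+.setoid

  L : List (Subset m)
  -- The added `⊥` raises the length by one, and `𝒥<` unfolds to exactly `length L ≤ 2 ^ k`.
  L = ⊥ ∷ filter 𝒥? (allSubsets m)

  open Correction k L 𝒥<

  w w+ : Subset m → ℤ
  w = baseWeight k N
  w+ S = w S ℤ.+ totalCorrection S

  w′ : Subset m → ℕ
  -- By `corrected-nonneg` the absolute value returns `w+ S` itself, now as a natural number.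
  w′ S = ℤ.∣ w+ S ∣

  wCoeff≈w : ∀ S → Nonempty S → wCoeff f* S ≈ fromℤ (w S)
  wCoeff≈w S S≢∅ with k ℕ.<? ∣ S ∣
  ... | yes k<S = large S k<S
  ... | no  k≮S = small S S≢∅ (ℕ.≮⇒≥ k≮S)

  agrees : ∀ T → 𝒥 T → real (coverage w′ T) ≈ f* T
  agrees T T∈𝒥 = begin
    real (coverage w′ T)
      ≡⟨ real-coverage w′ T ⟩
    fromℤ (ℤΣ.sum (allSubsets m) (λ S → ℤΣ.[ meets S T ]· + w′ S))
      ≡⟨ ≡.cong fromℤ (ℤΣ.sum-cong (allSubsets m) (λ S →
           ≡.cong (ℤΣ.[ meets S T ]·_) (ℤ.0≤i⇒+∣i∣≡i (corrected-nonneg N> S)))) ⟩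
    fromℤ (ℤΣ.sum (allSubsets m) (λ S → ℤΣ.[ meets S T ]· w+ S))
      ≡⟨ ≡.cong fromℤ (corrected-agrees (here ≡.refl) w
           (there (∈-filter⁺ 𝒥? (∈-allSubsets T) T∈𝒥))) ⟩
    fromℤ (ℤΣ.sum (allSubsets m) (λ S → ℤΣ.[ meets S T ]· w S))
      ≈⟨ prescribed-values f* w f*⊥≈0 wCoeff≈w T ⟨
    f* T ∎
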